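{- Let $G$ be a connected graph with vertex set $\{u_1,\dots,u_n\}$, $n\ge2$, let $U_1,\dots,U_k$ be the non-singleton true twin equivalence classes of $G$, and let $\mathcal{H}=\{H_1,\dots,H_n\}$ be a family of graphs. Then $$\operatorname{adim}_l(G\circ\mathcal{H})=\sum_{i=1}^n\operatorname{adim}_l(H_i)+\sum_{j:\,I\cap U_j\ne\emptyset}(|I\cap U_j|-1)+\varrho'(G,\mathcal{H}).$$
   Context: All graphs are finite and simple with at least one vertex. $d_G$ is shortest-path distance ($+\infty$ between components), $d_{G,2}(x,y)=\min\{d_G(x,y),2\}$; $s$ distinguishes $x,y$ w.r.t. $d$ if $d(s,x)\ne d(s,y)$. $\operatorname{adim}_l(H)$ is the minimum size of $S\subseteq V(H)$ such that any two adjacent vertices of $H$ are distinguished w.r.t. $d_{H,2}$ by some vertex of $S$; minimum such sets are local adjacency bases. $\Phi$: class of edgeless graphs. $\mathcal{G}$: class of graphs $H$ such that every local adjacency basis $B$ of $H$ satisfies $B\subseteq N_H(v)$ for some $v\in V(H)$. True twins: $N[x]=N[y]$. Lexicographic product $G\circ\mathcal{H}$: vertex set $\bigcup_i\{u_i\}\times V(H_i)$, $(u_i,v)\sim(u_j,w)$ iff $u_iu_j\in E(G)$, or $i=j$ and $vw\in E(H_i)$. Notation: $T(G)=\bigcup_j U_j$; $V_E=\{u_i\in V(G)-T(G): H_i\in\Phi\}$; $I=\{u_i: H_i\in\mathcal{G}\}$; for each $j$ with $I\cap U_j\ne\emptyset$ choose (arbitrarily) one vertex of $I\cap U_j$ and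 let $I'_j$ be the remaining vertices of $I\cap U_j$ ($I'_j=\emptyset$ otherwise); $X_E=I-\bigcup_jI'_j$. Two vertices $u_i,u_j\in X_E$ satisfy $\mathcal{R}'$ iff $u_i\sim u_j$ and $d_{G,2}(u,u_i)=d_{G,2}(u,u_j)$ for all $u\in V(G)-(V_E\cup\{u_i,u_j\})$. $\varrho'(G,\mathcal{H})$ is the minimum $|A|$ over $A\subseteq X_E$ such that every pair $u_i,u_j\in X_E$ satisfying $\mathcal{R}'$ is distinguished by some vertex of $A$ (w.r.t. $d_{G,2}$). -}

module Defs where

open import Data.Bool using (if_then_else_)
open import Data.Nat
  using (ℕ; zero; suc; _+_; _∸_; _⊓_; _≤_; _<_; z≤n; s≤s; _<?_)
import Data.Nat as ℕ
import Data.Nat.Properties as ℕ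
open import Data.Nat.Induction using (<-rec)
open import Data.Fin using (Fin; zero; suc; toℕ; fromℕ<; splitAt; _↑ˡ_; _↑ʳ_; _≟_)
import Data.Fin.Properties as Fin
open import Data.Fin.Properties using (any?; all?; pigeonhole)
open import Data.Fin.Subset
  using (Subset; _∈_; _∉_; _⊆_; _∩_; _∪_; _─_; _-_; ⋃; ⁅_⁆; ∣_∣; ⊤; Nonempty)
open import Data.Fin.Subset.Properties
  using (_∈?_; _⊆?_; nonempty?; anySubset?; ⊆-refl; ∈⊤)
import Data.List as List
open import Data.Product using (Σ; ∃; _×_; _,_)
open import Data.Sum using (inj₁; inj₂)
open import Data.Vec using (tabulate)
open import Function using (_∘_; _↔_; _⇔_; mk↔ₛ′; Injective)
open import Relation.Binary.PropositionalEquality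
  using (_≡_; _≢_; refl; sym; trans; cong; subst)
open import Relation.Nullary using (Dec; yes; no; does; ¬_; contradiction)
open import Relation.Nullary.Construct.Add.Supremum using (_⁺; [_]; ⊤⁺)
open import Relation.Nullary.Decidable
  using (map′; ¬?; _×-dec_; _→-dec_; decidable-stable)
open import Relation.Unary using (Decidable)

open import Algebra.Properties.CommutativeMonoid.Sum ℕ.+-0-commutativeMonoid public
  using (sum)

record Least (P : ℕ → Set) : Set where
  field
    value : ℕ
    holds : P value
    least : ∀ {l} → P l → value ≤ l

open Least public

findLeast : {P : ℕ → Set} → Decidable P → ∀ k → P k → Least P
findLeast P? k p with P? 0
... | yes p₀ = record { value = 0 ; holds = p₀ ; least = λ _ → z≤n }
findLeast P? zero    p | no ¬p₀ = contradiction p ¬p₀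
findLeast P? (suc k) p | no ¬p₀ with findLeast (P? ∘ suc) k p
... | record { value = l ; holds = q ; least = min } = record
  { value = suc l
  ; holds = q
  ; least = λ { {zero} p₀ → contradiction p₀ ¬p₀ ; {suc _} p′ → s≤s (min p′) }
  }

HasSize : ∀ {n} → (Subset n → Set) → ℕ → Set
HasSize P c = ∃ λ S → P S × ∣ S ∣ ≡ c

minSize : ∀ {n} {P : Subset n → Set} → Decidable P → ∃ P → Least (HasSize P)
minSize P? (S , p) =
  findLeast (λ c → anySubset? (λ S → P? S ×-dec (∣ S ∣ ℕ.≟ c))) ∣ S ∣ (S , p , refl)

record Graph (n : ℕ) : Set₁ where
  field
    Adj      : Fin n → Fin n → Set
    adj?     : ∀ x y → Dec (Adj x y)
    adj-sym  : ∀ {x y} → Adj x y → Adj y x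
    adj-irr  : ∀ {x} → ¬ Adj x x
    nonEmpty : 0 < n

open Graph public

infix 4 _⊢_~_
_⊢_~_ : ∀ {n} → Graph n → Fin n → Fin n → Set
G ⊢ x ~ y = Adj G x y

⟪_⟫ : ∀ {n} {P : Fin n → Set} → Decidable P → Subset n
⟪ P? ⟫ = tabulate (does ∘ P?)

N : ∀ {n} → Graph n → Fin n → Subset n
N G x = ⟪ adj? G x ⟫

N[_] : ∀ {n} → Graph n → Fin n → Subset n
N[ G ] x = N G x ∪ ⁅ x ⁆

data Walk {n} (G : Graph n) : ℕ → Fin n → Fin n → Set where
  []  : ∀ {x} → Walk G 0 x x
  _∷_ : ∀ {l x y z} → G ⊢ x ~ y → Walk G l y z → Walk G (suc l) x z

Connected : ∀ {n} → Graph n → Set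
Connected G = ∀ x y → ∃ λ l → Walk G l x y

data Distance {n} (G : Graph n) (x y : Fin n) : Set where
  finite   : Least (λ l → Walk G l x y) → Distance G x y
  infinite : (∀ l → ¬ Walk G l x y) → Distance G x y

module _ {n} (G : Graph n) where

  walk? : ∀ x y → Decidable (λ l → Walk G l x y)
  walk? x y zero    = map′ (λ { refl → [] }) (λ { [] → refl }) (x ≟ y)
  walk? x y (suc l) = map′ (λ { (_ , e , w) → e ∷ w }) (λ { (e ∷ w) → _ , e , w })
    (any? (λ z → adj? G x z ×-dec walk? z y l))

  private
    at : ∀ {l x y} → Walk G l x y → Fin (suc l) → Fin n
    at {x = x} w       zero    = x
    at         (_ ∷ w) (suc i) = at w i

    take : ∀ {l x y} (w : Walk G l x y) i → Walk G (toℕ i) x (at w i)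
    take w       zero    = []
    take (e ∷ w) (suc i) = e ∷ take w i

    drop : ∀ {l x y} (w : Walk G l x y) i → Walk G (l ∸ toℕ i) (at w i) y
    drop w       zero    = w
    drop (_ ∷ w) (suc i) = drop w i

    _++_ : ∀ {k l x y z} → Walk G k x y → Walk G l y z → Walk G (k + l) x z
    []      ++ w = w
    (e ∷ v) ++ w = e ∷ (v ++ w)

    cut : ∀ {l x y} → n ≤ l → Walk G l x y → ∃ λ k → k < l × Walk G k x y
    cut {l} n≤l w with pigeonhole (s≤s n≤l) (at w)
    ... | i , j , i<j , eq = toℕ i + (l ∸ toℕ j) , shorter
                           , take w i ++ subst (λ v → Walk G _ v _) (sym eq) (drop w j)
      where
      shorter : toℕ i + (l ∸ toℕ j) < l
      shorter = subst (toℕ i + (l ∸ toℕ j) <_)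
        (ℕ.m+[n∸m]≡n (ℕ.≤-pred (Fin.toℕ<n j)))
        (ℕ.+-monoˡ-< (l ∸ toℕ j) i<j)

    shorten : ∀ l {x y} → Walk G l x y → ∃ λ k → k < n × Walk G k x y
    shorten = <-rec _ step
      where
      step : ∀ l → (∀ {k} → k < l → ∀ {x y} → Walk G k x y → ∃ λ k → k < n × Walk G k x y)
           → ∀ {x y} → Walk G l x y → ∃ λ k → k < n × Walk G k x y
      step l rec w with l <? n
      ... | yes l<n = l , l<n , w
      ... | no  l≮n with cut (ℕ.≮⇒≥ l≮n) w
      ...   | k , k<l , w′ = rec k<l w′

  distance : ∀ x y → Distance G x y
  distance x y with any? {n = n} (λ l → walk? x y (toℕ l))
  ... | yes (l , w) = finite (findLeast (walk? x y) (toℕ l) w)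
  ... | no  ¬w      = infinite λ l w → let k , k<n , w′ = shorten l w in
    ¬w (fromℕ< k<n , subst (λ k → Walk G k x y) (sym (Fin.toℕ-fromℕ< k<n)) w′)

  -- a shortest walk is a path, so this is the length of a shortest path
  d : Fin n → Fin n → ℕ ⁺
  d x y with distance x y
  ... | finite l   = [ value l ]
  ... | infinite _ = ⊤⁺

truncate : ℕ → ℕ ⁺ → ℕ
truncate t [ l ] = l ⊓ t
truncate t ⊤⁺    = t

d₂ : ∀ {n} → Graph n → Fin n → Fin n → ℕ
d₂ G x y = truncate 2 (d G x y)

d₂-refl : ∀ {n} (G : Graph n) x → d₂ G x x ≡ 0
d₂-refl G x with distance G x x
... | finite l    rewrite ℕ.n≤0⇒n≡0 (least l []) = refl
... | infinite ¬w = contradiction [] (¬w 0)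

d₂≡0⇒≡ : ∀ {n} (G : Graph n) {x y} → d₂ G x y ≡ 0 → x ≡ y
d₂≡0⇒≡ G {x} {y} eq with distance G x y
... | finite record { value = zero ; holds = [] } = refl

Distinguishes : ∀ {n} → Graph n → Fin n → Fin n → Fin n → Set
Distinguishes G s x y = d₂ G s x ≢ d₂ G s y

distinguishes? : ∀ {n} (G : Graph n) s x y → Dec (Distinguishes G s x y)
distinguishes? G s x y = ¬? (d₂ G s x ℕ.≟ d₂ G s y)

self-distinguishes : ∀ {n} (G : Graph n) {x y} → G ⊢ x ~ y → Distinguishes G x x y
self-distinguishes G {x} x~y eq
  with refl ← d₂≡0⇒≡ G (trans (sym eq) (d₂-refl G x)) = adj-irr G x~y

module _ {n} (G : Graph n) where

  LocalAdjGenerator : Subset n → Set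
  LocalAdjGenerator S =
    ∀ x y → G ⊢ x ~ y → ∃ λ s → s ∈ S × Distinguishes G s x y

  localAdjGenerator? : Decidable LocalAdjGenerator
  localAdjGenerator? S = all? λ x → all? λ y →
    adj? G x y →-dec any? (λ s → (s ∈? S) ×-dec distinguishes? G s x y)

  minLocalAdjGenerator : Least (HasSize LocalAdjGenerator)
  minLocalAdjGenerator = minSize localAdjGenerator?
    (⊤ , λ x y x~y → x , ∈⊤ , self-distinguishes G x~y)

  adimₗ : ℕ
  adimₗ = value minLocalAdjGenerator

  LocalAdjBasis : Subset n → Set
  LocalAdjBasis B = LocalAdjGenerator B × ∣ B ∣ ≡ adimₗ

  localAdjBasis? : Decidable LocalAdjBasis
  localAdjBasis? B = localAdjGenerator? B ×-dec (∣ B ∣ ℕ.≟ adimₗ)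

Φ : ∀ {n} → Graph n → Set
Φ H = ∀ x y → ¬ H ⊢ x ~ y

Φ? : ∀ {n} (H : Graph n) → Dec (Φ H)
Φ? H = all? λ x → all? λ y → ¬? (adj? H x y)

𝒢 : ∀ {n} → Graph n → Set
𝒢 H = ∀ B → LocalAdjBasis H B → ∃ λ v → B ⊆ N H v

allSubset? : ∀ {n} {P : Subset n → Set} → Decidable P → Dec (∀ S → P S)
allSubset? P? = map′
  (λ ¬∃ S → decidable-stable (P? S) (λ ¬p → ¬∃ (S , ¬p)))
  (λ all (S , ¬p) → ¬p (all S))
  (¬? (anySubset? (¬? ∘ P?)))

𝒢? : ∀ {n} (H : Graph n) → Dec (𝒢 H)
𝒢? H = allSubset? λ B → localAdjBasis? H B →-dec any? (λ v → B ⊆? N H v)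

module _ {n} (G : Graph n) where

  TrueTwins : Fin n → Fin n → Set
  TrueTwins x y = N[ G ] x ≡ N[ G ] y

  TrueTwinClass : Subset n → Set
  TrueTwinClass C = ∃ λ x → ∀ y → y ∈ C ⇔ TrueTwins x y

  -- U₁, …, Uₖ lists all non-singleton classes, each exactly once
  record NonSingletonTrueTwinClasses {k} (U : Fin k → Subset n) : Set where
    field
      distinct     : Injective _≡_ _≡_ U
      class        : ∀ j → TrueTwinClass (U j)
      nonSingleton : ∀ j → 1 < ∣ U j ∣
      complete     : ∀ C → TrueTwinClass C → 1 < ∣ C ∣ → ∃ λ j → U j ≡ C

flatten : ∀ {n} (m : Fin n → ℕ) → Σ (Fin n) (Fin ∘ m) → Fin (sum m)
flatten {suc n} m (zero  , v) = v ↑ˡ sum (m ∘ suc)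
flatten {suc n} m (suc i , v) = m zero ↑ʳ flatten (m ∘ suc) (i , v)

unflatten : ∀ {n} (m : Fin n → ℕ) → Fin (sum m) → Σ (Fin n) (Fin ∘ m)
unflatten {suc n} m x with splitAt (m zero) x
... | inj₁ v = zero , v
... | inj₂ y = let i , v = unflatten (m ∘ suc) y in suc i , v

flatten-unflatten : ∀ {n} (m : Fin n → ℕ) x → flatten m (unflatten m x) ≡ x
flatten-unflatten {suc n} m x with splitAt (m zero) x in eq
... | inj₁ v = Fin.splitAt⁻¹-↑ˡ eq
... | inj₂ y = trans (cong (m zero ↑ʳ_) (flatten-unflatten (m ∘ suc) y))
                     (Fin.splitAt⁻¹-↑ʳ eq)

unflatten-flatten : ∀ {n} (m : Fin n → ℕ) p → unflatten m (flatten m p) ≡ p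
unflatten-flatten {suc n} m (zero , v)
  rewrite Fin.splitAt-↑ˡ (m zero) v (sum (m ∘ suc)) = refl
unflatten-flatten {suc n} m (suc i , v)
  rewrite Fin.splitAt-↑ʳ (m zero) (sum (m ∘ suc)) (flatten (m ∘ suc) (i , v))
        | unflatten-flatten (m ∘ suc) (i , v) = refl

Fin-sum↔Σ : ∀ {n} (m : Fin n → ℕ) → Fin (sum m) ↔ Σ (Fin n) (Fin ∘ m)
Fin-sum↔Σ m =
  mk↔ₛ′ (unflatten m) (flatten m) (unflatten-flatten m) (flatten-unflatten m)

module _ {n} (G : Graph n) {m : Fin n → ℕ} (H : ∀ i → Graph (m i)) where

  data LexAdj : Σ (Fin n) (Fin ∘ m) → Σ (Fin n) (Fin ∘ m) → Set where
    outer : ∀ {i j v w} → G ⊢ i ~ j   → LexAdj (i , v) (j , w)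
    inner : ∀ {i v w}   → H i ⊢ v ~ w → LexAdj (i , v) (i , w)

  lexAdj? : ∀ p q → Dec (LexAdj p q)
  lexAdj? (i , v) (j , w) with adj? G i j | i ≟ j
  ... | yes i~j | _        = yes (outer i~j)
  ... | no  i≁j | no  i≢j  = no λ { (outer i~j) → i≁j i~j ; (inner _) → i≢j refl }
  ... | no  i≁j | yes refl = map′ inner
    (λ { (outer i~j) → contradiction i~j i≁j ; (inner v~w) → v~w }) (adj? (H i) v w)

  lexAdj-sym : ∀ {p q} → LexAdj p q → LexAdj q p
  lexAdj-sym (outer i~j) = outer (adj-sym G i~j)
  lexAdj-sym (inner v~w) = inner (adj-sym (H _) v~w)

  lexAdj-irr : ∀ {p} → ¬ LexAdj p p
  lexAdj-irr (outer i~i) = adj-irr G i~i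
  lexAdj-irr (inner v~v) = adj-irr (H _) v~v

  private
    0<sum : ∀ {n} (m : Fin n → ℕ) → 0 < n → (∀ i → 0 < m i) → 0 < sum m
    0<sum m (s≤s _) 0<m = ℕ.≤-trans (0<m zero) (ℕ.m≤m+n _ _)

  -- the vertices (uᵢ , v) are numbered consecutively through Fin-sum↔Σ
  lex : Graph (sum m)
  lex = record
    { Adj      = λ x y → LexAdj (unflatten m x) (unflatten m y)
    ; adj?     = λ x y → lexAdj? (unflatten m x) (unflatten m y)
    ; adj-sym  = lexAdj-sym
    ; adj-irr  = lexAdj-irr
    ; nonEmpty = 0<sum m (nonEmpty G) (nonEmpty ∘ H)
    }

I : ∀ {n} {m : Fin n → ℕ} → (∀ i → Graph (m i)) → Subset n
I H = ⟪ (λ i → 𝒢? (H i)) ⟫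

-- r j is the vertex chosen from I ∩ U j; when that set is empty, r j is
-- unconstrained and plays no role (I′ j below is then empty)
IsChoice : ∀ {n k} {m : Fin n → ℕ} → (∀ i → Graph (m i)) →
           (Fin k → Subset n) → (Fin k → Fin n) → Set
IsChoice H U r = ∀ j → Nonempty (I H ∩ U j) → r j ∈ I H ∩ U j

twinSum : ∀ {n k} {m : Fin n → ℕ} → (∀ i → Graph (m i)) → (Fin k → Subset n) → ℕ
twinSum H U = sum λ j →
  if does (nonempty? (I H ∩ U j)) then ∣ I H ∩ U j ∣ ∸ 1 else 0

module _ {n k} (G : Graph n) {m : Fin n → ℕ} (H : ∀ i → Graph (m i))
         (U : Fin k → Subset n) (r : Fin k → Fin n) where

  T : Subset n
  T = ⋃ (List.tabulate U)

  V_E : Subset n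
  V_E = ⟪ (λ i → Φ? (H i)) ⟫ ─ T

  I′ : Fin k → Subset n
  I′ j = (I H ∩ U j) - r j

  X_E : Subset n
  X_E = I H ─ ⋃ (List.tabulate I′)

  R′ : Fin n → Fin n → Set
  R′ i j = G ⊢ i ~ j × (∀ u → u ∉ V_E ∪ (⁅ i ⁆ ∪ ⁅ j ⁆) → d₂ G u i ≡ d₂ G u j)

  R′? : ∀ i j → Dec (R′ i j)
  R′? i j = adj? G i j ×-dec
    all? (λ u → ¬? (u ∈? V_E ∪ (⁅ i ⁆ ∪ ⁅ j ⁆)) →-dec (d₂ G u i ℕ.≟ d₂ G u j))

  R′Generator : Subset n → Set
  R′Generator A = A ⊆ X_E ×
    (∀ i j → i ∈ X_E → j ∈ X_E → R′ i j → ∃ λ a → a ∈ A × Distinguishes G a i j)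

  R′Generator? : Decidable R′Generator
  R′Generator? A = (A ⊆? X_E) ×-dec (all? λ i → all? λ j →
    (i ∈? X_E) →-dec ((j ∈? X_E) →-dec (R′? i j →-dec
      any? (λ a → (a ∈? A) ×-dec distinguishes? G a i j))))

  minR′Generator : Least (HasSize R′Generator)
  minR′Generator = minSize R′Generator?
    (X_E , ⊆-refl , λ i j i∈X _ (i~j , _) → i , i∈X , self-distinguishes G i~j)

  ϱ′ : ℕ
  ϱ′ = value minR′Generator

{-# OPTIONS --safe #-}
module Submission where

-- A set S is a local adjacency generator of G ∘ H iff every slice Sᵢ is one of
-- Hᵢ and, whenever uᵢ ~ uⱼ and both slices are dominated (contained in some
-- N(v)), a third u_k with S_k ≠ ∅ distinguishes uᵢ from uⱼ.  Avoiding domination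
-- costs nothing for i ∉ I and exactly one extra vertex for i ∈ I.  So one has to
-- minimise the set M ⊆ I of paid vertices: true twins in I cannot both stay
-- unpaid, which gives the twin sum, and discarding twins turns what remains of M
-- into a set A as in the definition of ϱ′; conversely M = (I ─ X_E) ∪ A suffices.

open import Defs
open import Data.Nat using (ℕ; _+_; _≤_)
open import Data.Fin using (Fin)
open import Data.Fin.Subset using (Subset)
open import Relation.Binary.PropositionalEquality using (_≡_)

open import Data.Bool using (Bool; true; false; if_then_else_)
import Data.Bool as Bool
open import Data.Nat using (zero; suc; _∸_; _<_; z≤n; s≤s; _<?_)
import Data.Nat.Properties as ℕ
open import Data.Fin using (zero; suc; _↑ˡ_; _↑ʳ_; _≟_; fromℕ<)
open import Data.Fin.Properties using (any?; all?; suc-injective)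
open import Data.Fin.Subset
  using (_∈_; _∉_; _⊆_; _∩_; _∪_; _─_; _-_; ⋃; ⁅_⁆; ∣_∣; ⊥; Nonempty; Empty; inside; outside)
open import Data.Fin.Subset.Properties
open import Data.List using (tabulate)
open import Data.Product using (Σ; ∃; _×_; _,_; proj₁; proj₂)
open import Data.Sum using (inj₁; inj₂; [_,_]′)
open import Data.Vec using ([]; _∷_; here; there; lookup)
import Data.Vec as Vec
import Data.Vec.Properties as Vec
open import Function using (_∘_; _⇔_; mk⇔; Equivalence)
open import Relation.Binary.PropositionalEquality
  using (_≢_; refl; sym; trans; cong; cong₂; subst; subst₂; ≢-sym; module ≡-Reasoning)
open import Relation.Nullary using (Dec; yes; no; does; ¬_; contradiction)
open import Relation.Nullary.Decidable
  using (¬?; _×-dec_; _→-dec_; decidable-stable; dec-true)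
open import Relation.Unary using (Decidable)
open import Algebra.Properties.CommutativeMonoid.Sum ℕ.+-0-commutativeMonoid
  using (sum-cong-≗; ∑-distrib-+)

open Equivalence using (to; from)

private
  variable
    n n′ : ℕ
    i j x y z : Fin n
    p q : Subset n

-- Finite sums and cardinalities

∈⟪⟫⁺ : {P : Fin n → Set} (P? : Decidable P) → P x → x ∈ ⟪ P? ⟫
∈⟪⟫⁺ {x = x} P? px = Vec.lookup⇒[]= x _
  (trans (Vec.lookup∘tabulate (does ∘ P?) x) (dec-true (P? x) px))

∈⟪⟫⁻ : {P : Fin n → Set} (P? : Decidable P) → x ∈ ⟪ P? ⟫ → P x
∈⟪⟫⁻ {x = x} P? x∈ with P? x
  | trans (sym (Vec.lookup∘tabulate (does ∘ P?) x)) (Vec.[]=⇒lookup x∈)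
... | yes px | _ = px

x∈p─q⇒x∉q : ∀ (p q : Subset n) → x ∈ p ─ q → x ∉ q
x∈p─q⇒x∉q (_ ∷ p) (_ ∷ q) (there x∈) (there x∈q) = x∈p─q⇒x∉q p q x∈ x∈q
x∈p─q⇒x∉q (_ ∷ p) (inside ∷ q) () here

∣p─q∣+∣p∩q∣≡∣p∣ : ∀ (p q : Subset n) → ∣ p ─ q ∣ + ∣ p ∩ q ∣ ≡ ∣ p ∣
∣p─q∣+∣p∩q∣≡∣p∣ []            []            = refl
∣p─q∣+∣p∩q∣≡∣p∣ (outside ∷ p) (outside ∷ q) = ∣p─q∣+∣p∩q∣≡∣p∣ p q
∣p─q∣+∣p∩q∣≡∣p∣ (outside ∷ p) (inside  ∷ q) = ∣p─q∣+∣p∩q∣≡∣p∣ p q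
∣p─q∣+∣p∩q∣≡∣p∣ (inside  ∷ p) (outside ∷ q) = cong suc (∣p─q∣+∣p∩q∣≡∣p∣ p q)
∣p─q∣+∣p∩q∣≡∣p∣ (inside  ∷ p) (inside  ∷ q) =
  trans (ℕ.+-suc _ _) (cong suc (∣p─q∣+∣p∩q∣≡∣p∣ p q))

∣p∪q∣+∣p∩q∣≡∣p∣+∣q∣ : ∀ (p q : Subset n) → ∣ p ∪ q ∣ + ∣ p ∩ q ∣ ≡ ∣ p ∣ + ∣ q ∣
∣p∪q∣+∣p∩q∣≡∣p∣+∣q∣ []            []            = refl
∣p∪q∣+∣p∩q∣≡∣p∣+∣q∣ (outside ∷ p) (outside ∷ q) = ∣p∪q∣+∣p∩q∣≡∣p∣+∣q∣ p q
∣p∪q∣+∣p∩q∣≡∣p∣+∣q∣ (outside ∷ p) (inside  ∷ q) =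
  trans (cong suc (∣p∪q∣+∣p∩q∣≡∣p∣+∣q∣ p q)) (sym (ℕ.+-suc _ _))
∣p∪q∣+∣p∩q∣≡∣p∣+∣q∣ (inside  ∷ p) (outside ∷ q) = cong suc (∣p∪q∣+∣p∩q∣≡∣p∣+∣q∣ p q)
∣p∪q∣+∣p∩q∣≡∣p∣+∣q∣ (inside  ∷ p) (inside  ∷ q) = cong suc
  (trans (ℕ.+-suc _ _) (trans (cong suc (∣p∪q∣+∣p∩q∣≡∣p∣+∣q∣ p q)) (sym (ℕ.+-suc _ _))))

q⊆p⇒∣p─q∣+∣q∣≡∣p∣ : q ⊆ p → ∣ p ─ q ∣ + ∣ q ∣ ≡ ∣ p ∣
q⊆p⇒∣p─q∣+∣q∣≡∣p∣ {q = q} {p = p} q⊆p = subst (λ s → ∣ p ─ q ∣ + ∣ s ∣ ≡ ∣ p ∣)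
  (⊆-antisym (p∩q⊆q p q) (λ x∈q → x∈p∩q⁺ (q⊆p x∈q , x∈q))) (∣p─q∣+∣p∩q∣≡∣p∣ p q)

Empty⇒∣p∣≡0 : ∀ {p : Subset n} → Empty p → ∣ p ∣ ≡ 0
Empty⇒∣p∣≡0 {n} e = trans (cong ∣_∣ (Empty-unique e)) (∣⊥∣≡0 n)

x∈p⇒0<∣p∣ : x ∈ p → 0 < ∣ p ∣
x∈p⇒0<∣p∣ x∈p = ℕ.≤-<-trans z≤n (x∈p⇒∣p-x∣<∣p∣ x∈p)

disjoint⇒∣p∪q∣≡∣p∣+∣q∣ : (∀ {x} → x ∈ p → x ∉ q) → ∣ p ∪ q ∣ ≡ ∣ p ∣ + ∣ q ∣
disjoint⇒∣p∪q∣≡∣p∣+∣q∣ {p = p} {q = q} disj = begin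
  ∣ p ∪ q ∣              ≡⟨ ℕ.+-identityʳ _ ⟨
  ∣ p ∪ q ∣ + 0          ≡⟨ cong (∣ p ∪ q ∣ +_) (Empty⇒∣p∣≡0 none) ⟨
  ∣ p ∪ q ∣ + ∣ p ∩ q ∣  ≡⟨ ∣p∪q∣+∣p∩q∣≡∣p∣+∣q∣ p q ⟩
  ∣ p ∣ + ∣ q ∣          ∎
  where
  open ≡-Reasoning
  none : Empty (p ∩ q)
  none (x , x∈) = let x∈p , x∈q = x∈p∩q⁻ p q x∈ in disj x∈p x∈q

x≢y⇒1<∣p∣ : x ≢ y → x ∈ p → y ∈ p → 1 < ∣ p ∣
x≢y⇒1<∣p∣ x≢y x∈p y∈p =
  ℕ.≤-<-trans (x∈p⇒0<∣p∣ (x∈p∧x≢y⇒x∈p-y y∈p (≢-sym x≢y))) (x∈p⇒∣p-x∣<∣p∣ x∈p)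

1<∣p∣⇒another : ∀ (p : Subset n) x → 1 < ∣ p ∣ → ∃ λ y → y ∈ p × y ≢ x
1<∣p∣⇒another p x 1<∣p∣ with nonempty? (p - x)
... | yes (y , y∈) =
  y , p─q⊆p p ⁅ x ⁆ y∈ , λ { refl → x∈p─q⇒x∉q p ⁅ x ⁆ y∈ (x∈⁅x⁆ x) }
... | no  none     = contradiction 1<∣p∣ (ℕ.≤⇒≯ (begin
  ∣ p ∣                        ≡⟨ ∣p─q∣+∣p∩q∣≡∣p∣ p ⁅ x ⁆ ⟨
  ∣ p - x ∣ + ∣ p ∩ ⁅ x ⁆ ∣    ≡⟨ cong (_+ ∣ p ∩ ⁅ x ⁆ ∣) (Empty⇒∣p∣≡0 none) ⟩
  ∣ p ∩ ⁅ x ⁆ ∣                ≤⟨ ∣p∩q∣≤∣q∣ p ⁅ x ⁆ ⟩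
  ∣ ⁅ x ⁆ ∣                    ≡⟨ ∣⁅x⁆∣≡1 x ⟩
  1                            ∎))
  where open ℕ.≤-Reasoning

∈⋃⁺ : ∀ (f : Fin n′ → Subset n) j → x ∈ f j → x ∈ ⋃ (tabulate f)
∈⋃⁺ f zero    x∈ = x∈p∪q⁺ (inj₁ x∈)
∈⋃⁺ f (suc j) x∈ = x∈p∪q⁺ (inj₂ (∈⋃⁺ (f ∘ suc) j x∈))

∈⋃⁻ : ∀ (f : Fin n′ → Subset n) → x ∈ ⋃ (tabulate f) → ∃ λ j → x ∈ f j
∈⋃⁻ {n′ = zero}  f x∈ = contradiction x∈ ∉⊥
∈⋃⁻ {n′ = suc _} f x∈ with x∈p∪q⁻ (f zero) _ x∈
... | inj₁ x∈₀ = zero , x∈₀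
... | inj₂ x∈′ = let j , x∈ⱼ = ∈⋃⁻ (f ∘ suc) x∈′ in suc j , x∈ⱼ

∣⋃∣≡sum : ∀ (f : Fin n′ → Subset n) → (∀ {i j x} → x ∈ f i → x ∈ f j → i ≡ j) →
          ∣ ⋃ (tabulate f) ∣ ≡ sum (∣_∣ ∘ f)
∣⋃∣≡sum {n′ = zero}  {n = n} f disj = ∣⊥∣≡0 n
∣⋃∣≡sum {n′ = suc _} f disj = trans
  (disjoint⇒∣p∪q∣≡∣p∣+∣q∣ λ x∈₀ x∈′ → let _ , x∈ⱼ = ∈⋃⁻ (f ∘ suc) x∈′ in
    contradiction (disj x∈₀ x∈ⱼ) λ ())
  (cong (∣ f zero ∣ +_) (∣⋃∣≡sum (f ∘ suc) λ x∈ᵢ x∈ⱼ → suc-injective (disj x∈ᵢ x∈ⱼ)))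

-- A relation replaces an injection, so that `TrueTwins` can be used directly. Each step removes
-- from `q` the partner `y` of the first element; injectivity keeps later partners away from `y`.
matching⇒∣p∣≤∣q∣ : ∀ (p : Subset n) (q : Subset n′) (R : Fin n → Fin n′ → Set) →
  (∀ {x} → x ∈ p → ∃ λ y → y ∈ q × R x y) →
  (∀ {x x′ y} → x ∈ p → x′ ∈ p → R x y → R x′ y → x ≡ x′) →
  ∣ p ∣ ≤ ∣ q ∣
matching⇒∣p∣≤∣q∣ []            q R match inj = z≤n
matching⇒∣p∣≤∣q∣ (outside ∷ p) q R match inj = matching⇒∣p∣≤∣q∣ p q (R ∘ suc)
  (match ∘ there) (λ x∈ x′∈ r r′ → suc-injective (inj (there x∈) (there x′∈) r r′))
matching⇒∣p∣≤∣q∣ (inside  ∷ p) q R match inj with match here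
... | y , y∈q , r₀ = ℕ.≤-<-trans
  (matching⇒∣p∣≤∣q∣ p (q - y) (R ∘ suc)
    (λ x∈ → let y′ , y′∈q , r = match (there x∈) in
      y′ , x∈p∧x≢y⇒x∈p-y y′∈q (λ { refl → contradiction (inj here (there x∈) r₀ r) λ () }) , r)
    (λ x∈ x′∈ r r′ → suc-injective (inj (there x∈) (there x′∈) r r′)))
  (x∈p⇒∣p-x∣<∣p∣ y∈q)

sum-mono-≤ : {f g : Fin n → ℕ} → (∀ i → f i ≤ g i) → sum f ≤ sum g
sum-mono-≤ {n = zero}  f≤g = z≤n
sum-mono-≤ {n = suc _} f≤g = ℕ.+-mono-≤ (f≤g zero) (sum-mono-≤ (f≤g ∘ suc))

sum-++ : ∀ m {l} (f : Fin (m + l) → ℕ) → sum f ≡ sum (f ∘ (_↑ˡ l)) + sum (f ∘ (m ↑ʳ_))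
sum-++ zero    f = refl
sum-++ (suc m) f =
  trans (cong (f zero +_) (sum-++ m (f ∘ suc))) (sym (ℕ.+-assoc (f zero) _ _))

sum-flatten : ∀ (m : Fin n → ℕ) (f : Fin (sum m) → ℕ) →
              sum f ≡ sum (λ i → sum (λ v → f (flatten m (i , v))))
sum-flatten {n = zero}  m f = refl
sum-flatten {n = suc _} m f = trans (sum-++ (m zero) f)
  (cong (sum (λ v → f (flatten m (zero , v))) +_) (sum-flatten (m ∘ suc) (f ∘ (m zero ↑ʳ_))))

𝟙 : Bool → ℕ
𝟙 b = if b then 1 else 0

∣tabulate∣≡sum : ∀ (f : Fin n → Bool) → ∣ Vec.tabulate f ∣ ≡ sum (𝟙 ∘ f)
∣tabulate∣≡sum {n = zero}  f = refl
∣tabulate∣≡sum {n = suc _} f with f zero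
... | true  = cong suc (∣tabulate∣≡sum (f ∘ suc))
... | false = ∣tabulate∣≡sum (f ∘ suc)

∣p∣≡sum : ∀ (p : Subset n) → ∣ p ∣ ≡ sum (𝟙 ∘ lookup p)
∣p∣≡sum p = trans (cong ∣_∣ (sym (Vec.tabulate∘lookup p))) (∣tabulate∣≡sum (lookup p))

sum-+-∣p∣ : ∀ (f : Fin n → ℕ) (p : Subset n) →
            sum (λ i → f i + 𝟙 (lookup p i)) ≡ sum f + ∣ p ∣
sum-+-∣p∣ f p = trans (∑-distrib-+ f _) (cong (sum f +_) (sym (∣p∣≡sum p)))

-- Every index in `p` has at least one unit to spare; adding the indicator of `p` to `f` uses up
-- these units.
sum+∣p∣≤sum : ∀ {f g : Fin n → ℕ} (p : Subset n) → (∀ i → f i ≤ g i) →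
              (∀ {i} → i ∈ p → f i < g i) → sum f + ∣ p ∣ ≤ sum g
sum+∣p∣≤sum {f = f} {g} p f≤g f<g = subst (_≤ sum g) (sum-+-∣p∣ f p) (sum-mono-≤ each)
  where
  each : ∀ i → f i + 𝟙 (lookup p i) ≤ g i
  each i with lookup p i in eq
  ... | true  = subst (_≤ g i) (ℕ.+-comm 1 (f i)) (f<g (Vec.lookup⇒[]= i p eq))
  ... | false = subst (_≤ g i) (sym (ℕ.+-identityʳ (f i))) (f≤g i)

-- Truncated distances, dominated sets and local adjacency bases

d₂≡1 : ∀ (G : Graph n) → G ⊢ x ~ y → d₂ G x y ≡ 1
d₂≡1 {x = x} {y = y} G x~y with distance G x y
... | infinite ¬w = contradiction (x~y ∷ []) (¬w 1)
... | finite record { value = 0 ; holds = [] } = contradiction x~y (adj-irr G)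
... | finite record { value = 1 } = refl
... | finite record { value = suc (suc _) ; least = least } with least (x~y ∷ [])
...   | s≤s ()

d₂≡2 : ∀ (G : Graph n) → x ≢ y → ¬ G ⊢ x ~ y → d₂ G x y ≡ 2
d₂≡2 {x = x} {y = y} G x≢y x≁y with distance G x y
... | infinite _ = refl
... | finite record { value = 0 ; holds = [] } = contradiction refl x≢y
... | finite record { value = 1 ; holds = x~y ∷ [] } = contradiction x~y x≁y
... | finite record { value = suc (suc l) } = cong (2 +_) (ℕ.⊓-zeroʳ l)

d₂≡1⇒~ : ∀ (G : Graph n) → d₂ G x y ≡ 1 → G ⊢ x ~ y
d₂≡1⇒~ {x = x} {y = y} G eq with adj? G x y | x ≟ y
... | yes x~y | _        = x~y
... | no  _   | yes refl = contradiction (trans (sym eq) (d₂-refl G x)) λ ()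
... | no  x≁y | no  x≢y  = contradiction (trans (sym eq) (d₂≡2 G x≢y x≁y)) λ ()

-- Truncation at 2 leaves only the values 0, 1 and 2, which equality and adjacency decide. Distances
-- in different graphs can therefore be compared without looking at walks.
d₂-cong : ∀ (G : Graph n) (G′ : Graph n′) {x y x′ y′} →
          x ≡ y ⇔ x′ ≡ y′ → G ⊢ x ~ y ⇔ G′ ⊢ x′ ~ y′ → d₂ G x y ≡ d₂ G′ x′ y′
d₂-cong G G′ {x} {y} {x′} eq adj with x ≟ y | adj? G x y
... | yes refl | _ with refl ← to eq refl = trans (d₂-refl G x) (sym (d₂-refl G′ x′))
... | no  x≢y | yes x~y = trans (d₂≡1 G x~y) (sym (d₂≡1 G′ (to adj x~y)))
... | no  x≢y | no  x≁y =
  trans (d₂≡2 G x≢y x≁y) (sym (d₂≡2 G′ (x≢y ∘ from eq) (x≁y ∘ from adj)))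

d₂-sym : ∀ (G : Graph n) x y → d₂ G x y ≡ d₂ G y x
d₂-sym G x y = d₂-cong G G (mk⇔ sym sym) (mk⇔ (adj-sym G) (adj-sym G))

module _ (G : Graph n) where

  ∈N⁺ : G ⊢ x ~ y → y ∈ N G x
  ∈N⁺ {x = x} = ∈⟪⟫⁺ (adj? G x)

  ∈N⁻ : y ∈ N G x → G ⊢ x ~ y
  ∈N⁻ {x = x} = ∈⟪⟫⁻ (adj? G x)

  -- `z` lies in the common closed neighbourhood, and `y ≢ z` rules out that it is there only as its
  -- centre `y`.
  twin-adj : TrueTwins G x y → y ≢ z → G ⊢ x ~ z → G ⊢ y ~ z
  twin-adj {x = x} {y = y} {z = z} x≈y y≢z x~z
    with x∈p∪q⁻ (N G y) ⁅ y ⁆ (subst (z ∈_) x≈y (x∈p∪q⁺ (inj₁ (∈N⁺ x~z))))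
  ... | inj₁ z∈N = ∈N⁻ z∈N
  ... | inj₂ z∈y = contradiction (sym (x∈⁅y⁆⇒x≡y y z∈y)) y≢z

  twins-adjacent : TrueTwins G x y → x ≢ y → G ⊢ x ~ y
  twins-adjacent {x = x} {y = y} x≈y x≢y
    with x∈p∪q⁻ (N G x) ⁅ x ⁆ (subst (y ∈_) (sym x≈y) (x∈p∪q⁺ (inj₂ (x∈⁅x⁆ y))))
  ... | inj₁ y∈N = ∈N⁻ y∈N
  ... | inj₂ y∈x = contradiction (sym (x∈⁅y⁆⇒x≡y x y∈x)) x≢y

  twins-d₂ : TrueTwins G x y → z ≢ x → z ≢ y → d₂ G x z ≡ d₂ G y z
  twins-d₂ x≈y z≢x z≢y = d₂-cong G G
    (mk⇔ (λ x≡z → contradiction (sym x≡z) z≢x) (λ y≡z → contradiction (sym y≡z) z≢y))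
    (mk⇔ (twin-adj x≈y (≢-sym z≢y)) (twin-adj (sym x≈y) (≢-sym z≢x)))

  twins-d₂ʳ : TrueTwins G x y → z ≢ x → z ≢ y → d₂ G z x ≡ d₂ G z y
  twins-d₂ʳ x≈y z≢x z≢y =
    trans (d₂-sym G _ _) (trans (twins-d₂ x≈y z≢x z≢y) (d₂-sym G _ _))

  -- `𝒢 G` says that every local adjacency basis is dominated in this sense. The empty set is
  -- dominated by every vertex.
  Dominated : Subset n → Set
  Dominated B = ∃ λ v → B ⊆ N G v

  dominated? : Decidable Dominated
  dominated? B = any? λ v → B ⊆? N G v

  adimₗ≤ : ∀ {B} → LocalAdjGenerator G B → adimₗ G ≤ ∣ B ∣
  adimₗ≤ {B} gen = least (minLocalAdjGenerator G) (B , gen , refl)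

  Empty⇒Dominated : ∀ {B} → Empty B → Dominated B
  Empty⇒Dominated e = fromℕ< (nonEmpty G) , λ x∈B → contradiction (_ , x∈B) e

  Φ⇒adimₗ≡0 : Φ G → adimₗ G ≡ 0
  Φ⇒adimₗ≡0 φ = ℕ.n≤0⇒n≡0 (subst (adimₗ G ≤_) (∣⊥∣≡0 n)
    (adimₗ≤ {⊥} λ x y x~y → contradiction x~y (φ x y)))

  -- Without edges the only local adjacency basis is the empty set.
  Φ⇒𝒢 : Φ G → 𝒢 G
  Φ⇒𝒢 φ B (_ , ∣B∣≡) = Empty⇒Dominated λ (_ , x∈B) →
    ℕ.<⇒≢ (x∈p⇒0<∣p∣ x∈B) (sym (trans ∣B∣≡ (Φ⇒adimₗ≡0 φ)))

  ¬Φ⇒Nonempty : ∀ {B} → ¬ Φ G → LocalAdjGenerator G B → Nonempty B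
  ¬Φ⇒Nonempty {B} ¬φ gen with nonempty? B
  ... | yes ne = ne
  ... | no  e  = contradiction
    (λ x y x~y → let s , s∈B , _ = gen x y x~y in e (s , s∈B)) ¬φ

  -- There are finitely many subsets and both conditions are decidable, so a search turns the
  -- negated universal statement into a witness.
  ¬𝒢⇒undominatedBasis : ¬ 𝒢 G → ∃ λ B → LocalAdjBasis G B × ¬ Dominated B
  ¬𝒢⇒undominatedBasis ¬𝒢G = decidable-stable
    (anySubset? λ B → localAdjBasis? G B ×-dec ¬? (dominated? B))
    λ none → ¬𝒢G λ B basis → decidable-stable (dominated? B) λ ¬dom → none (B , basis , ¬dom)

  -- A vertex w dominating B ∪ {v} would be adjacent to v, but no element of
  -- B ⊆ N(v) ∩ N(w) distinguishes v from w.
  𝒢⇒undominatedGenerator : 𝒢 G →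
    ∃ λ B → LocalAdjGenerator G B × ∣ B ∣ ≤ adimₗ G + 1 × ¬ Dominated B
  𝒢⇒undominatedGenerator 𝒢G with holds (minLocalAdjGenerator G)
  ... | B , gen , ∣B∣≡ with 𝒢G B (gen , ∣B∣≡)
  ...   | v , B⊆Nv = B ∪ ⁅ v ⁆
    , (λ x y x~y → let s , s∈B , dist = gen x y x~y in s , x∈p∪q⁺ (inj₁ s∈B) , dist)
    , size , undominated
    where
    open ℕ.≤-Reasoning
    size : ∣ B ∪ ⁅ v ⁆ ∣ ≤ adimₗ G + 1
    size = begin
      ∣ B ∪ ⁅ v ⁆ ∣                    ≤⟨ ℕ.m≤m+n _ _ ⟩
      ∣ B ∪ ⁅ v ⁆ ∣ + ∣ B ∩ ⁅ v ⁆ ∣    ≡⟨ ∣p∪q∣+∣p∩q∣≡∣p∣+∣q∣ B ⁅ v ⁆ ⟩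
      ∣ B ∣ + ∣ ⁅ v ⁆ ∣                ≡⟨ cong₂ _+_ ∣B∣≡ (∣⁅x⁆∣≡1 v) ⟩
      adimₗ G + 1                      ∎
    undominated : ¬ Dominated (B ∪ ⁅ v ⁆)
    undominated (w , ⊆Nw) with gen w v (∈N⁻ (⊆Nw (x∈p∪q⁺ (inj₂ (x∈⁅x⁆ v)))))
    ... | s , s∈B , dist = dist (trans
      (d₂≡1 G (adj-sym G (∈N⁻ (⊆Nw (x∈p∪q⁺ (inj₁ s∈B))))))
      (sym (d₂≡1 G (adj-sym G (∈N⁻ (B⊆Nv s∈B))))))

-- Local adjacency generators of a lexicographic product

module _ (m : Fin n → ℕ) where

  flattened : ∀ s → ∃ λ p → flatten m p ≡ s
  flattened s = unflatten m s , flatten-unflatten m s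

  slice : Subset (sum m) → ∀ i → Subset (m i)
  slice S i = Vec.tabulate λ v → lookup S (flatten m (i , v))

  ∈slice⁺ : ∀ {S i v} → flatten m (i , v) ∈ S → v ∈ slice S i
  ∈slice⁺ {S} {i} {v} ∈S = Vec.lookup⇒[]= v _
    (trans (Vec.lookup∘tabulate _ v) (Vec.[]=⇒lookup ∈S))

  ∈slice⁻ : ∀ {S i v} → v ∈ slice S i → flatten m (i , v) ∈ S
  ∈slice⁻ {S} {i} {v} v∈ = Vec.lookup⇒[]= _ S
    (trans (sym (Vec.lookup∘tabulate _ v)) (Vec.[]=⇒lookup v∈))

  ∣S∣≡sum∣slice∣ : ∀ S → ∣ S ∣ ≡ sum (λ i → ∣ slice S i ∣)
  ∣S∣≡sum∣slice∣ S = begin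
    ∣ S ∣                                               ≡⟨ ∣p∣≡sum S ⟩
    sum (𝟙 ∘ lookup S)                                  ≡⟨ sum-flatten m (𝟙 ∘ lookup S) ⟩
    sum (λ i → sum λ v → 𝟙 (lookup S (flatten m (i , v))))
      ≡⟨ sum-cong-≗ (λ i → ∣tabulate∣≡sum (λ v → lookup S (flatten m (i , v)))) ⟨
    sum (λ i → ∣ slice S i ∣)                           ∎
    where open ≡-Reasoning

  join : (∀ i → Subset (m i)) → Subset (sum m)
  join B = Vec.tabulate λ s → lookup (B (proj₁ (unflatten m s))) (proj₂ (unflatten m s))

  slice-join : ∀ B i → slice (join B) i ≡ B i
  slice-join B i = trans (Vec.tabulate-cong at) (Vec.tabulate∘lookup (B i))
    where
    at : ∀ v → lookup (join B) (flatten m (i , v)) ≡ lookup (B i) v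
    at v = trans (Vec.lookup∘tabulate _ (flatten m (i , v)))
      (cong (λ (i , v) → lookup (B i) v) (unflatten-flatten m (i , v)))

  ∣join∣≡sum : ∀ B → ∣ join B ∣ ≡ sum (λ i → ∣ B i ∣)
  ∣join∣≡sum B = trans (∣S∣≡sum∣slice∣ (join B)) (sum-cong-≗ (cong ∣_∣ ∘ slice-join B))

module _ (G : Graph n) {m : Fin n → ℕ} (H : ∀ i → Graph (m i)) where

  private
    L : Graph (sum m)
    L = lex G H

    _▹_ : ∀ i → Fin (m i) → Fin (sum m)
    i ▹ v = flatten m (i , v)

    ▹-injective : ∀ {i j v w} → i ▹ v ≡ j ▹ w → (i , v) ≡ (j , w)
    ▹-injective {i} {j} {v} {w} eq = trans (sym (unflatten-flatten m (i , v)))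
      (trans (cong (unflatten m) eq) (unflatten-flatten m (j , w)))

    lexAdj⁺ : ∀ {p q} → LexAdj G H p q → L ⊢ flatten m p ~ flatten m q
    lexAdj⁺ = subst₂ (LexAdj G H) (sym (unflatten-flatten m _)) (sym (unflatten-flatten m _))

    lexAdj⁻ : ∀ {p q} → L ⊢ flatten m p ~ flatten m q → LexAdj G H p q
    lexAdj⁻ = subst₂ (LexAdj G H) (unflatten-flatten m _) (unflatten-flatten m _)

  -- The untruncated distances may differ, since a walk in the product can leave the copy of `H i`
  -- and return. Nonadjacent distinct vertices are nevertheless at truncated distance 2 in both
  -- graphs.
  d₂-inner : ∀ i v w → d₂ L (i ▹ v) (i ▹ w) ≡ d₂ (H i) v w
  d₂-inner i v w = d₂-cong L (H i)
    (mk⇔ (λ eq → same (▹-injective eq)) (cong (i ▹_)))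
    (mk⇔ (λ e → within (lexAdj⁻ e)) (lexAdj⁺ ∘ inner))
    where
    same : _≡_ {A = Σ (Fin n) (Fin ∘ m)} (i , v) (i , w) → v ≡ w
    same refl = refl
    within : LexAdj G H (i , v) (i , w) → H i ⊢ v ~ w
    within (outer i~i) = contradiction i~i (adj-irr G)
    within (inner v~w) = v~w

  d₂-outer : i ≢ j → ∀ v w → d₂ L (i ▹ v) (j ▹ w) ≡ d₂ G i j
  d₂-outer {i = i} {j = j} i≢j v w = d₂-cong L G
    (mk⇔ (cong proj₁ ∘ ▹-injective) (λ i≡j → contradiction i≡j i≢j))
    (mk⇔ (λ e → across (lexAdj⁻ e)) (lexAdj⁺ ∘ outer))
    where
    across : LexAdj G H (i , v) (j , w) → G ⊢ i ~ j
    across (outer i~j) = i~j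
    across (inner _)   = contradiction refl i≢j

  -- By `d₂-outer` all vertices of copy `k` have the same distances to copies `i` and `j`, so only
  -- nonemptiness of `B k` matters.
  Separated : (∀ i → Subset (m i)) → Fin n → Fin n → Set
  Separated B i j = ∃ λ k → k ≢ i × k ≢ j × Nonempty (B k) × Distinguishes G k i j

  LexGenerator : (∀ i → Subset (m i)) → Set
  LexGenerator B = (∀ i → LocalAdjGenerator (H i) (B i))
    × (∀ i j → G ⊢ i ~ j → Dominated (H i) (B i) → Dominated (H j) (B j) → Separated B i j)

  -- For the second condition take `v` and `w` dominating the two slices. Every element of slice `i`
  -- or slice `j` is then at distance 1 from both `(i , v)` and `(j , w)`, so the vertex
  -- distinguishing this pair comes from a third copy.
  lexGenerator⁻ : ∀ {S} → LocalAdjGenerator L S → LexGenerator (slice m S)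
  lexGenerator⁻ {S} gen = within , across
    where
    within : ∀ i → LocalAdjGenerator (H i) (slice m S i)
    within i v w v~w with gen (i ▹ v) (i ▹ w) (lexAdj⁺ (inner v~w))
    ... | s , s∈S , dist with flattened m s
    ...   | (k , x) , refl with k ≟ i
    ...     | yes refl = x , ∈slice⁺ m s∈S , λ eq →
      dist (trans (d₂-inner i x v) (trans eq (sym (d₂-inner i x w))))
    -- A vertex of another copy is equally far from all vertices of copy `i`.
    ...     | no  k≢i  = contradiction
      (trans (d₂-outer k≢i x v) (sym (d₂-outer k≢i x w))) dist

    across : ∀ i j → G ⊢ i ~ j → Dominated (H i) (slice m S i) →
             Dominated (H j) (slice m S j) → Separated (slice m S) i j
    across i j i~j (v , ⊆Nv) (w , ⊆Nw) with gen (i ▹ v) (j ▹ w) (lexAdj⁺ (outer i~j))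
    ... | s , s∈S , dist with flattened m s
    ...   | (k , x) , refl with k ≟ i | k ≟ j
    ...     | yes refl | yes refl = contradiction i~j (adj-irr G)
    ...     | yes refl | no  i≢j  = contradiction
      (trans (trans (d₂-inner i x v) (d₂≡1 (H i) (adj-sym (H i) (∈N⁻ (H i) (⊆Nv (∈slice⁺ m s∈S))))))
        (sym (trans (d₂-outer i≢j x w) (d₂≡1 G i~j)))) dist
    ...     | no  j≢i  | yes refl = contradiction
      (trans (trans (d₂-outer j≢i x v) (d₂≡1 G (adj-sym G i~j)))
        (sym (trans (d₂-inner j x w) (d₂≡1 (H j) (adj-sym (H j) (∈N⁻ (H j) (⊆Nw (∈slice⁺ m s∈S)))))))) dist
    ...     | no  k≢i  | no  k≢j  = k , k≢i , k≢j , (x , ∈slice⁺ m s∈S) , λ eq →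
      dist (trans (d₂-outer k≢i x v) (trans eq (sym (d₂-outer k≢j x w))))

  -- For vertices `(i , v)` and `(j , w)` across an edge, an element of `B i` outside `N(v)` is at
  -- distance 1 from `(j , w)` but not from `(i , v)`; the same holds with the roles exchanged. If
  -- neither kind of element exists, `v` and `w` witness domination and a third copy separates the
  -- pair.
  lexGenerator⁺ : ∀ {B} → LexGenerator B → LocalAdjGenerator L (join m B)
  lexGenerator⁺ {B} (within , across) s t s~t =
    subst₂ (λ s t → ∃ λ u → u ∈ join m B × Distinguishes L u s t)
      (flatten-unflatten m s) (flatten-unflatten m t) (distinguish s~t)
    where
    ∈join : ∀ {i v} → v ∈ B i → i ▹ v ∈ join m B
    ∈join {i} v∈ = ∈slice⁻ m (subst (_ ∈_) (sym (slice-join m B i)) v∈)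

    outside-N : ∀ {i j} v w → G ⊢ i ~ j → ¬ (B i ⊆ N (H i) v) →
                ∃ λ u → u ∈ join m B × Distinguishes L u (i ▹ v) (j ▹ w)
    outside-N {i} {j} v w i~j ⊈Nv
      with any? (λ x → (x ∈? B i) ×-dec ¬? (adj? (H i) v x))
    ... | yes (x , x∈ , v≁x) = i ▹ x , ∈join x∈ , λ eq → v≁x (adj-sym (H i) (d₂≡1⇒~ (H i)
      (trans (sym (d₂-inner i x v)) (trans eq
        (trans (d₂-outer (λ { refl → adj-irr G i~j }) x w) (d₂≡1 G i~j))))))
    ... | no  none = contradiction (λ {x} x∈ → ∈N⁺ (H i)
      (decidable-stable (adj? (H i) v x) λ v≁x → none (x , x∈ , v≁x))) ⊈Nv

    distinguish : ∀ {p q} → LexAdj G H p q →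
      ∃ λ u → u ∈ join m B × Distinguishes L u (flatten m p) (flatten m q)
    distinguish (inner {i} {v} {w} v~w) = let x , x∈ , dist = within i v w v~w in
      i ▹ x , ∈join x∈ , λ eq →
        dist (trans (sym (d₂-inner i x v)) (trans eq (d₂-inner i x w)))
    distinguish (outer {i} {j} {v} {w} i~j) with B i ⊆? N (H i) v | B j ⊆? N (H j) w
    ... | no ⊈Nv | _       = outside-N v w i~j ⊈Nv
    ... | yes _  | no ⊈Nw = let u , u∈ , dist = outside-N w v (adj-sym G i~j) ⊈Nw in
      u , u∈ , ≢-sym dist
    ... | yes ⊆Nv | yes ⊆Nw =
      let k , k≢i , k≢j , (x , x∈) , dist = across i j i~j (v , ⊆Nv) (w , ⊆Nw) in
      k ▹ x , ∈join x∈ , λ eq →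
        dist (trans (sym (d₂-outer k≢i x v)) (trans eq (d₂-outer k≢j x w)))

-- Representatives of the true twin classes

-- In the application J, X and T are I, X_E and T(G), and t is the twin sum.
record Representatives (G : Graph n) (J X T : Subset n) (t : ℕ) : Set where
  field
    X⊆J                   : X ⊆ J
    ∣X∣+t≡∣J∣             : ∣ X ∣ + t ≡ ∣ J ∣
    representative        : x ∈ J → ∃ λ y → y ∈ X × TrueTwins G x y
    representative-unique : x ∈ X → y ∈ X → TrueTwins G x y → x ≡ y
    ∈T⇒twin               : x ∈ T → ∃ λ y → y ≢ x × TrueTwins G x y
    twin⇒∈T               : x ≢ y → TrueTwins G x y → y ∈ T

trueTwins? : ∀ (G : Graph n) x y → Dec (TrueTwins G x y)
trueTwins? G x y = Vec.≡-dec Bool._≟_ (N[ G ] x) (N[ G ] y)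

module _ (G : Graph n) {k} (J : Subset n) (U : Fin k → Subset n) (r : Fin k → Fin n)
         (classes : NonSingletonTrueTwinClasses G U)
         (choice : ∀ j → Nonempty (J ∩ U j) → r j ∈ J ∩ U j) where

  open NonSingletonTrueTwinClasses classes

  private
    rest : Fin k → Subset n
    rest j = (J ∩ U j) - r j

    W X : Subset n
    W = ⋃ (tabulate rest)
    X = J ─ W

    class-twins : x ∈ U j → y ∈ U j → TrueTwins G x y
    class-twins {j = j} x∈ y∈ = let _ , ∈⇔ = class j in
      trans (sym (to (∈⇔ _) x∈)) (to (∈⇔ _) y∈)

    class-closed : x ∈ U j → TrueTwins G x y → y ∈ U j
    class-closed {j = j} x∈ x≈y = let _ , ∈⇔ = class j in
      from (∈⇔ _) (trans (to (∈⇔ _) x∈) x≈y)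

    -- The class `C` of `x` contains both `x` and `y`, so it is not a singleton and `complete` lists
    -- it.
    common-class : x ≢ y → TrueTwins G x y → ∃ λ j → x ∈ U j × y ∈ U j
    common-class {x = x} {y = y} x≢y x≈y =
      let j , Uj≡C = complete C (x , λ z → mk⇔ (∈⟪⟫⁻ (trueTwins? G x)) (∈⟪⟫⁺ (trueTwins? G x)))
                       (x≢y⇒1<∣p∣ x≢y x∈C y∈C)
      in j , subst (x ∈_) (sym Uj≡C) x∈C , subst (y ∈_) (sym Uj≡C) y∈C
      where
      C : Subset n
      C = ⟪ trueTwins? G x ⟫
      x∈C : x ∈ C
      x∈C = ∈⟪⟫⁺ (trueTwins? G x) refl
      y∈C : y ∈ C
      y∈C = ∈⟪⟫⁺ (trueTwins? G x) x≈y

    U-disjoint : x ∈ U i → x ∈ U j → i ≡ j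
    U-disjoint x∈i x∈j = distinct (⊆-antisym
      (λ y∈i → class-closed x∈j (class-twins x∈i y∈i))
      (λ y∈j → class-closed x∈i (class-twins x∈j y∈j)))

    rest⁻ : ∀ j → x ∈ rest j → x ∈ J × x ∈ U j
    rest⁻ j x∈ = x∈p∩q⁻ J (U j) (p─q⊆p (J ∩ U j) ⁅ r j ⁆ x∈)

    -- A class other than `U j` misses `r j` by disjointness, and `rest j` has `r j` deleted.
    r∉rest : ∀ i j → r j ∈ U j → r j ∉ rest i
    r∉rest i j rj∈U r∈ with refl ← U-disjoint (proj₂ (rest⁻ i r∈)) rj∈U =
      x∈p─q⇒x∉q (J ∩ U i) ⁅ r i ⁆ r∈ (x∈⁅x⁆ (r i))

    ∣rest∣ : ∀ j → (if does (nonempty? (J ∩ U j)) then ∣ J ∩ U j ∣ ∸ 1 else 0) ≡ ∣ rest j ∣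
    ∣rest∣ j with nonempty? (J ∩ U j)
    ... | yes ne = begin
      ∣ J ∩ U j ∣ ∸ 1                  ≡⟨ cong (_∸ 1) (q⊆p⇒∣p─q∣+∣q∣≡∣p∣ ⁅r⁆⊆) ⟨
      ∣ rest j ∣ + ∣ ⁅ r j ⁆ ∣ ∸ 1     ≡⟨ cong (λ c → ∣ rest j ∣ + c ∸ 1) (∣⁅x⁆∣≡1 (r j)) ⟩
      ∣ rest j ∣ + 1 ∸ 1               ≡⟨ ℕ.m+n∸n≡m _ 1 ⟩
      ∣ rest j ∣                       ∎
      where
      open ≡-Reasoning
      ⁅r⁆⊆ : ⁅ r j ⁆ ⊆ J ∩ U j
      ⁅r⁆⊆ x∈ with refl ← x∈⁅y⁆⇒x≡y (r j) x∈ = choice j ne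
    -- Here `r j` is unconstrained, but removing it from an empty set still leaves nothing.
    ... | no  e  = sym (Empty⇒∣p∣≡0 λ (x , x∈) → e (x , p─q⊆p (J ∩ U j) ⁅ r j ⁆ x∈))

    -- An element of `J` that survives in `X` represents itself; one discarded into `rest j` is
    -- represented by `r j`.
    representative : x ∈ J → ∃ λ y → y ∈ X × TrueTwins G x y
    representative {x = x} x∈J with x ∈? W
    ... | no  x∉ = x , x∈p∧x∉q⇒x∈p─q x∈J x∉ , refl
    ... | yes x∈ =
      let j , x∈rest = ∈⋃⁻ rest x∈
          rj∈J , rj∈U = x∈p∩q⁻ J (U j) (choice j (x , x∈p∩q⁺ (rest⁻ j x∈rest)))
      in r j
       , x∈p∧x∉q⇒x∈p─q rj∈J (λ r∈ → let i , r∈rest = ∈⋃⁻ rest r∈ in r∉rest i j rj∈U r∈rest)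
       , class-twins (proj₂ (rest⁻ j x∈rest)) rj∈U

    -- Distinct twins share some `U j`, yet the only element of `X` that `U j` can contain is `r j`,
    -- all others of `J ∩ U j` having been discarded.
    representative-unique : x ∈ X → y ∈ X → TrueTwins G x y → x ≡ y
    representative-unique {x = x} {y = y} x∈X y∈X x≈y = decidable-stable (x ≟ y) λ x≢y →
      let j , x∈U , y∈U = common-class x≢y x≈y
      in x≢y (trans (≡r j x∈X x∈U) (sym (≡r j y∈X y∈U)))
      where
      ≡r : ∀ j → z ∈ X → z ∈ U j → z ≡ r j
      ≡r {z = z} j z∈X z∈U = decidable-stable (z ≟ r j) λ z≢r → x∈p─q⇒x∉q J W z∈X
        (∈⋃⁺ rest j (x∈p∧x≢y⇒x∈p-y (x∈p∩q⁺ (p─q⊆p J W z∈X , z∈U)) z≢r))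

  representatives : Representatives G J X (⋃ (tabulate U))
    (sum λ j → if does (nonempty? (J ∩ U j)) then ∣ J ∩ U j ∣ ∸ 1 else 0)
  representatives = record
    { X⊆J = p─q⊆p J W
    ; ∣X∣+t≡∣J∣ = trans
        (cong (∣ X ∣ +_) (trans (sum-cong-≗ ∣rest∣) (sym (∣⋃∣≡sum rest
          λ {i} {j} x∈i x∈j → U-disjoint (proj₂ (rest⁻ i x∈i)) (proj₂ (rest⁻ j x∈j))))))
        (q⊆p⇒∣p─q∣+∣q∣≡∣p∣ λ x∈ → let j , x∈rest = ∈⋃⁻ rest x∈ in proj₁ (rest⁻ j x∈rest))
    ; representative = representative
    ; representative-unique = representative-unique
    ; ∈T⇒twin = λ {x} x∈T →
        let j , x∈U = ∈⋃⁻ U x∈T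
            y , y∈U , y≢x = 1<∣p∣⇒another (U j) x (nonSingleton j)
        in y , y≢x , class-twins x∈U y∈U
    ; twin⇒∈T = λ x≢y x≈y → let j , _ , y∈U = common-class x≢y x≈y in ∈⋃⁺ U j y∈U
    }

-- The two bounds for the product.

module _ (G : Graph n) {m : Fin n → ℕ} (H : ∀ i → Graph (m i)) {J X T : Subset n} {t : ℕ}
         (J⇔𝒢 : ∀ i → i ∈ J ⇔ 𝒢 (H i)) (reps : Representatives G J X T t) where

  open Representatives reps

  -- u ∉ V_E is spelled out as Φ (H u) → u ∈ T.
  Related : Fin n → Fin n → Set
  Related i j = G ⊢ i ~ j
    × (∀ u → (Φ (H u) → u ∈ T) → u ≢ i → u ≢ j → d₂ G u i ≡ d₂ G u j)

  RelatedGenerator : Subset n → Set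
  RelatedGenerator A =
    A ⊆ X × (∀ i j → i ∈ X → j ∈ X → Related i j → ∃ λ a → a ∈ A × Distinguishes G a i j)

  private
    ∑adim : ℕ
    ∑adim = sum (λ i → adimₗ (H i))

    L : Graph (sum m)
    L = lex G H

  -- Lower bound: extracting `A` from a generator of the product.

  module _ {S : Subset (sum m)} (gen : LocalAdjGenerator L S) where

    private
      B : ∀ i → Subset (m i)
      B = slice m S

      within : ∀ i → LocalAdjGenerator (H i) (B i)
      within = proj₁ (lexGenerator⁻ G H gen)

      abstract
        excess? : Decidable (λ i → i ∈ J × adimₗ (H i) < ∣ B i ∣)
        excess? i = (i ∈? J) ×-dec (adimₗ (H i) <? ∣ B i ∣)

        -- The paid vertices: those of `J` whose slice is larger than a basis.
        M : Subset n
        M = ⟪ excess? ⟫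

        ∈M⁺ : i ∈ J → adimₗ (H i) < ∣ B i ∣ → i ∈ M
        ∈M⁺ i∈J lt = ∈⟪⟫⁺ excess? (i∈J , lt)

        ∈M⁻ : i ∈ M → i ∈ J × adimₗ (H i) < ∣ B i ∣
        ∈M⁻ = ∈⟪⟫⁻ excess?

      J─M⁻ : x ∈ J ─ M → x ∈ J × x ∉ M
      J─M⁻ x∈ = p─q⊆p J M x∈ , x∈p─q⇒x∉q J M x∈

      -- The slice of an unpaid vertex is a generator of minimum size, hence a basis, and membership
      -- in `J` says that bases are dominated.
      dominated : x ∈ J ─ M → Dominated (H x) (B x)
      dominated {x = x} x∈ = let x∈J , x∉M = J─M⁻ x∈ in
        to (J⇔𝒢 x) x∈J (B x) (within x , ℕ.≤-antisym
          (ℕ.≮⇒≥ λ lt → x∉M (∈M⁺ x∈J lt)) (adimₗ≤ (H x) (within x)))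

      separated : x ∈ J ─ M → y ∈ J ─ M → G ⊢ x ~ y → Separated G H B x y
      separated x∈ y∈ x~y =
        proj₂ (lexGenerator⁻ G H gen) _ _ x~y (dominated x∈) (dominated y∈)

      abstract
        untwinned? : Decidable (λ y → y ∈ X × (∀ x → x ∈ J ─ M → ¬ TrueTwins G x y))
        untwinned? y = (y ∈? X) ×-dec
          all? (λ x → (x ∈? J ─ M) →-dec ¬? (trueTwins? G x y))

        -- The representatives of those classes in which every vertex of `J` is paid.
        A : Subset n
        A = ⟪ untwinned? ⟫

        ∈A⁺ : y ∈ X → (∀ x → x ∈ J ─ M → ¬ TrueTwins G x y) → y ∈ A
        ∈A⁺ y∈X untwinned = ∈⟪⟫⁺ untwinned? (y∈X , untwinned)

        ∈A⁻ : y ∈ A → y ∈ X × (∀ x → x ∈ J ─ M → ¬ TrueTwins G x y)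
        ∈A⁻ = ∈⟪⟫⁻ untwinned?

      twin-of : y ∈ X → y ∉ A → ∃ λ x → x ∈ J ─ M × TrueTwins G x y
      twin-of {y = y} y∈X y∉A = decidable-stable
        (any? λ x → (x ∈? J ─ M) ×-dec trueTwins? G x y)
        λ none → y∉A (∈A⁺ y∈X λ x x∈ x≈y → none (x , x∈ , x≈y))

      -- Each unpaid vertex is matched with its representative, which is outside `A` by
      -- construction. Two unpaid vertices with the same representative would be adjacent twins,
      -- which no third vertex distinguishes, contrary to `separated`.
      ∣J─M∣≤∣X─A∣ : ∣ J ─ M ∣ ≤ ∣ X ─ A ∣
      ∣J─M∣≤∣X─A∣ = matching⇒∣p∣≤∣q∣ (J ─ M) (X ─ A) (TrueTwins G)
        (λ x∈ → let y , y∈X , x≈y = representative (proj₁ (J─M⁻ x∈)) in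
          y , x∈p∧x∉q⇒x∈p─q y∈X (λ y∈A → proj₂ (∈A⁻ y∈A) _ x∈ x≈y) , x≈y)
        λ {x} {x′} x∈ x′∈ x≈y x′≈y → decidable-stable (x ≟ x′) λ x≢x′ →
          let x≈x′ = trans x≈y (sym x′≈y)
              k , k≢x , k≢x′ , _ , dist =
                separated x∈ x′∈ (twins-adjacent G x≈x′ x≢x′)
          in dist (twins-d₂ʳ G x≈x′ k≢x k≢x′)

      ∣A∣+t≤∣M∣ : ∣ A ∣ + t ≤ ∣ M ∣
      -- Adding the number of unpaid vertices to both sides reduces the claim to `∣X∣+t≡∣J∣` and
      -- avoids subtraction.
      ∣A∣+t≤∣M∣ = ℕ.+-cancelˡ-≤ ∣ J ─ M ∣ _ _ (begin
        ∣ J ─ M ∣ + (∣ A ∣ + t)    ≤⟨ ℕ.+-monoˡ-≤ _ ∣J─M∣≤∣X─A∣ ⟩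
        ∣ X ─ A ∣ + (∣ A ∣ + t)    ≡⟨ ℕ.+-assoc ∣ X ─ A ∣ _ _ ⟨
        ∣ X ─ A ∣ + ∣ A ∣ + t      ≡⟨ cong (_+ t) (q⊆p⇒∣p─q∣+∣q∣≡∣p∣ (proj₁ ∘ ∈A⁻)) ⟩
        ∣ X ∣ + t                  ≡⟨ ∣X∣+t≡∣J∣ ⟩
        ∣ J ∣                      ≡⟨ q⊆p⇒∣p─q∣+∣q∣≡∣p∣ (proj₁ ∘ ∈M⁻) ⟨
        ∣ J ─ M ∣ + ∣ M ∣          ∎)
        where open ℕ.≤-Reasoning

      -- Outside `T` the class of `x` is just `x`. So `x` is its own representative, and the unpaid
      -- twin it would have if it were not in `A` could only be the paid vertex `x` itself.
      ∉T⇒∈A : x ∈ M → x ∉ T → x ∈ A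
      ∉T⇒∈A {x = x} x∈M x∉T = decidable-stable (x ∈? A) λ x∉A →
        let y , y∈J─M , y≈x = twin-of x∈X x∉A
        in proj₂ (J─M⁻ y∈J─M) (subst (_∈ M) (sym (only y≈x)) x∈M)
        where
        only : ∀ {y} → TrueTwins G y x → y ≡ x
        only {y} y≈x = decidable-stable (y ≟ x) λ y≢x → x∉T (twin⇒∈T y≢x y≈x)
        x∈X : x ∈ X
        x∈X = let y , y∈X , x≈y = representative (proj₁ (∈M⁻ x∈M)) in
          subst (_∈ X) (only (sym x≈y)) y∈X

      -- In an edgeless graph the dimension is 0, so any element of the slice is already an excess.
      nonempty⇒∈M : Φ (H x) → Nonempty (B x) → x ∈ M
      nonempty⇒∈M {x = x} φ (_ , v∈) = ∈M⁺ (from (J⇔𝒢 x) (Φ⇒𝒢 (H x) φ))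
        (subst (_< ∣ B x ∣) (sym (Φ⇒adimₗ≡0 (H x) φ)) (x∈p⇒0<∣p∣ v∈))

      -- Outside `A`, both `i` and `j` have unpaid twins `i′` and `j′`, which are again adjacent.
      -- The third vertex `k` separating them also distinguishes `i` from `j`; as these are
      -- `Related`, `H k` is edgeless and `k` is not in `T`. Since the slice of `k` is nonempty, `k`
      -- is paid, and having no twins it lies in `A`.
      A-distinguishes : ∀ i j → i ∈ X → j ∈ X → Related i j → i ∉ A → j ∉ A →
                        ∃ λ a → a ∈ A × Distinguishes G a i j
      A-distinguishes i j i∈X j∈X (i~j , same) i∉A j∉A =
        let i′ , i′∈ , i′≈i = twin-of i∈X i∉A
            j′ , j′∈ , j′≈j = twin-of j∈X j∉A
            i≢j : i ≢ j
            i≢j = λ { refl → adj-irr G i~j }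
            i≉j : ¬ TrueTwins G i j
            i≉j = i≢j ∘ representative-unique i∈X j∈X
            i′≢j : i′ ≢ j
            i′≢j = λ i′≡j → i≉j (trans (sym i′≈i) (cong N[ G ] i′≡j))
            j′≢i : j′ ≢ i
            j′≢i = λ j′≡i → i≉j (trans (cong N[ G ] (sym j′≡i)) j′≈j)
            i′≢j′ : i′ ≢ j′
            i′≢j′ = λ i′≡j′ → i≉j (trans (sym i′≈i) (trans (cong N[ G ] i′≡j′) j′≈j))
            i′~j = twin-adj G (sym i′≈i) i′≢j i~j
            j′~i′ = twin-adj G (sym j′≈j) (≢-sym i′≢j′) (adj-sym G i′~j)
            k , k≢i′ , k≢j′ , ne , dist = separated i′∈ j′∈ (adj-sym G j′~i′)
            -- If `k` were `i`, it would differ from its twin `i′` and be at distance 1 from both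
            -- `i′` and `j′`.
            k≢i : k ≢ i
            k≢i = λ k≡i → dist (undistinguished k≡i (sym i′≈i) k≢i′ j′≢i (adj-sym G j′~i′))
            k≢j : k ≢ j
            k≢j = λ k≡j → dist (sym (undistinguished k≡j (sym j′≈j) k≢j′ i′≢j j′~i′))
            dist′ : Distinguishes G k i j
            dist′ = λ eq → dist (trans (twins-d₂ʳ G i′≈i k≢i′ k≢i)
              (trans eq (sym (twins-d₂ʳ G j′≈j k≢j′ k≢j))))
            φ = decidable-stable (Φ? (H k)) λ ¬φ →
              dist′ (same k (λ φ → contradiction φ ¬φ) k≢i k≢j)
            k∉T : k ∉ T
            k∉T = λ k∈T → dist′ (same k (λ _ → k∈T) k≢i k≢j)
        in k , ∉T⇒∈A (nonempty⇒∈M φ ne) k∉T , dist′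
        where
        undistinguished : ∀ {k} → k ≡ x → TrueTwins G x y → k ≢ y → z ≢ x → G ⊢ y ~ z →
                          d₂ G k y ≡ d₂ G k z
        undistinguished refl x≈y x≢y z≢x y~z = trans (d₂≡1 G (twins-adjacent G x≈y x≢y))
          (sym (d₂≡1 G (twin-adj G (sym x≈y) (≢-sym z≢x) y~z)))

      A-generates : RelatedGenerator A
      A-generates = (proj₁ ∘ ∈A⁻) , λ i j i∈X j∈X R → cases R i∈X j∈X (i ∈? A) (j ∈? A)
        where
        cases : ∀ {i j} → Related i j → i ∈ X → j ∈ X → Dec (i ∈ A) → Dec (j ∈ A) →
                ∃ λ a → a ∈ A × Distinguishes G a i j
        cases (i~j , _) _   _   (yes i∈A) _         = _ , i∈A , self-distinguishes G i~j
        cases (i~j , _) _   _   (no _)    (yes j∈A) =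
          _ , j∈A , ≢-sym (self-distinguishes G (adj-sym G i~j))
        cases R         i∈X j∈X (no i∉A)  (no j∉A)  =
          A-distinguishes _ _ i∈X j∈X R i∉A j∉A

      size : ∑adim + ∣ M ∣ ≤ ∣ S ∣
      size = subst (∑adim + ∣ M ∣ ≤_) (sym (∣S∣≡sum∣slice∣ m S))
        (sum+∣p∣≤sum M (λ i → adimₗ≤ (H i) (within i)) (proj₂ ∘ ∈M⁻))

    lower-bound : ∃ λ A → RelatedGenerator A × ∑adim + t + ∣ A ∣ ≤ ∣ S ∣
    lower-bound = A , A-generates , (begin
      ∑adim + t + ∣ A ∣       ≡⟨ ℕ.+-assoc ∑adim _ _ ⟩
      ∑adim + (t + ∣ A ∣)     ≡⟨ cong (∑adim +_) (ℕ.+-comm _ ∣ A ∣) ⟩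
      ∑adim + (∣ A ∣ + t)     ≤⟨ ℕ.+-monoʳ-≤ ∑adim ∣A∣+t≤∣M∣ ⟩
      ∑adim + ∣ M ∣           ≤⟨ size ⟩
      ∣ S ∣                   ∎)
      where open ℕ.≤-Reasoning

  -- Upper bound: building a generator of the product from `A`.

  module _ {A : Subset n} (A-generates : RelatedGenerator A) where

    private
      A⊆X : A ⊆ X
      A⊆X = proj₁ A-generates

      -- Paying for `J ─ X` leaves at most one unpaid vertex of `J` in each true twin class.
      M : Subset n
      M = (J ─ X) ∪ A

      M⊆J : M ⊆ J
      M⊆J x∈M with x∈p∪q⁻ (J ─ X) A x∈M
      ... | inj₁ x∈J─X = p─q⊆p J X x∈J─X
      ... | inj₂ x∈A   = X⊆J (A⊆X x∈A)

      J∖M⁻ : x ∈ J → x ∉ M → x ∈ X × x ∉ A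
      J∖M⁻ {x = x} x∈J x∉M =
        decidable-stable (x ∈? X)
          (λ x∉X → x∉M (x∈p∪q⁺ (inj₁ (x∈p∧x∉q⇒x∈p─q x∈J x∉X))))
        , λ x∈A → x∉M (x∈p∪q⁺ (inj₂ x∈A))

      ∣M∣≡t+∣A∣ : ∣ M ∣ ≡ t + ∣ A ∣
      ∣M∣≡t+∣A∣ = trans
        (disjoint⇒∣p∪q∣≡∣p∣+∣q∣ λ x∈ x∈A → x∈p─q⇒x∉q J X x∈ (A⊆X x∈A))
        (cong (_+ ∣ A ∣) (ℕ.+-cancelʳ-≡ ∣ X ∣ _ _ (begin
          ∣ J ─ X ∣ + ∣ X ∣    ≡⟨ q⊆p⇒∣p─q∣+∣q∣≡∣p∣ X⊆J ⟩
          ∣ J ∣                ≡⟨ ∣X∣+t≡∣J∣ ⟨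
          ∣ X ∣ + t            ≡⟨ ℕ.+-comm ∣ X ∣ _ ⟩
          t + ∣ X ∣            ∎)))
        where open ≡-Reasoning

      record Suitable (i : Fin n) : Set where
        field
          B          : Subset (m i)
          within     : LocalAdjGenerator (H i) B
          size       : ∣ B ∣ ≤ adimₗ (H i) + 𝟙 (lookup M i)
          dominated⁻ : Dominated (H i) B → i ∈ J × i ∉ M

      -- A paid vertex spends its extra element on escaping domination, an unpaid vertex of `J`
      -- takes any basis, and a vertex outside `J` has an undominated basis at no extra cost.
      suitable : ∀ i → Dec (i ∈ M) → Dec (i ∈ J) → Suitable i
      suitable i (yes i∈M) _ =
        let B , gen , size , ¬dom = 𝒢⇒undominatedGenerator (H i) (to (J⇔𝒢 i) (M⊆J i∈M))
        in record
          { B          = B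
          ; within     = gen
          ; size       = subst (λ b → ∣ B ∣ ≤ adimₗ (H i) + 𝟙 b) (sym (Vec.[]=⇒lookup i∈M)) size
          ; dominated⁻ = λ dom → contradiction dom ¬dom
          }
      suitable i (no i∉M) (yes i∈J) =
        let B , gen , ∣B∣≡ = holds (minLocalAdjGenerator (H i))
        in record
          { B          = B
          ; within     = gen
          ; size       = ℕ.≤-trans (ℕ.≤-reflexive ∣B∣≡) (ℕ.m≤m+n _ _)
          ; dominated⁻ = λ _ → i∈J , i∉M
          }
      suitable i (no i∉M) (no i∉J) =
        let B , (gen , ∣B∣≡) , ¬dom = ¬𝒢⇒undominatedBasis (H i) (i∉J ∘ from (J⇔𝒢 i))
        in record
          { B          = B
          ; within     = gen
          ; size       = ℕ.≤-trans (ℕ.≤-reflexive ∣B∣≡) (ℕ.m≤m+n _ _)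
          ; dominated⁻ = λ dom → contradiction dom ¬dom
          }

      abstract
        choose : ∀ i → Suitable i
        choose i = suitable i (i ∈? M) (i ∈? J)

      module C i = Suitable (choose i)

      -- The empty set is dominated, whereas the slices at paid vertices are not.
      ∈M⇒Nonempty : i ∈ M → Nonempty (C.B i)
      ∈M⇒Nonempty {i = i} i∈M = decidable-stable (nonempty? (C.B i)) λ e →
        proj₂ (C.dominated⁻ i (Empty⇒Dominated (H i) e)) i∈M

      ¬Φ⇒Nonempty′ : ¬ Φ (H i) → Nonempty (C.B i)
      ¬Φ⇒Nonempty′ {i = i} ¬φ = ¬Φ⇒Nonempty (H i) ¬φ (C.within i)

      -- If H_u is edgeless and u ∈ J ∖ M is the representative of its class, a
      -- twin of u lies in M or outside J, and separates i from j in place of u.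
      separated : ∀ i j u → i ∈ J × i ∉ M → j ∈ J × j ∉ M → (Φ (H u) → u ∈ T) →
                  u ≢ i → u ≢ j → Distinguishes G u i j →
                  Dec (Φ (H u)) → Dec (u ∈ M) → Separated G H C.B i j
      separated i j u _ _ _ u≢i u≢j dist (no ¬φ) _ = u , u≢i , u≢j , ¬Φ⇒Nonempty′ ¬φ , dist
      separated i j u _ _ _ u≢i u≢j dist _ (yes u∈M) = u , u≢i , u≢j , ∈M⇒Nonempty u∈M , dist
      separated i j u (i∈J , i∉M) (j∈J , j∉M) φ⇒∈T u≢i u≢j dist (yes φ) (no u∉M)
        with ∈T⇒twin (φ⇒∈T φ)
      ... | w , w≢u , u≈w = w , w≢ i∈J i∉M , w≢ j∈J j∉M , nonempty (w ∈? M) , λ eq → dist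
        (trans (twins-d₂ G u≈w (≢-sym u≢i) (≢-sym (w≢ i∈J i∉M)))
          (trans eq (sym (twins-d₂ G u≈w (≢-sym u≢j) (≢-sym (w≢ j∈J j∉M))))))
        where
        -- `u` is in `J` because `Φ` implies `𝒢`. If `w` were also an unpaid vertex of `J`, both
        -- would be in `X`, which contains no two distinct twins.
        w∉J : w ∉ M → w ∉ J
        w∉J w∉M w∈J = w≢u (sym (representative-unique
          (proj₁ (J∖M⁻ (from (J⇔𝒢 u) (Φ⇒𝒢 (H u) φ)) u∉M)) (proj₁ (J∖M⁻ w∈J w∉M)) u≈w))
        w≢ : x ∈ J → x ∉ M → w ≢ x
        w≢ x∈J x∉M refl = w∉J x∉M x∈J
        nonempty : Dec (w ∈ M) → Nonempty (C.B w)
        nonempty (yes w∈M) = ∈M⇒Nonempty w∈M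
        nonempty (no w∉M)  = ¬Φ⇒Nonempty′ λ φw → w∉J w∉M (from (J⇔𝒢 w) (Φ⇒𝒢 (H w) φw))

      -- Domination forces `i` and `j` to be unpaid, hence representatives outside `A`. Either some
      -- third `u` outside `V_E` distinguishes them and `separated` applies, or they are `Related`
      -- and some `a` in `A` distinguishes them; `a` is paid, so its slice is nonempty, and it
      -- differs from `i` and `j` because these are not in `A`.
      across : ∀ i j → G ⊢ i ~ j → Dominated (H i) (C.B i) → Dominated (H j) (C.B j) →
               Separated G H C.B i j
      across i j i~j domᵢ domⱼ with any? (λ u → (Φ? (H u) →-dec (u ∈? T)) ×-dec
        (¬? (u ≟ i) ×-dec (¬? (u ≟ j) ×-dec distinguishes? G u i j)))
      ... | yes (u , φ⇒∈T , u≢i , u≢j , dist) =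
        separated i j u (C.dominated⁻ i domᵢ) (C.dominated⁻ j domⱼ) φ⇒∈T u≢i u≢j dist
          (Φ? (H u)) (u ∈? M)
      ... | no none =
        let i∈J , i∉M = C.dominated⁻ i domᵢ
            j∈J , j∉M = C.dominated⁻ j domⱼ
            i∈X , i∉A = J∖M⁻ i∈J i∉M
            j∈X , j∉A = J∖M⁻ j∈J j∉M
            a , a∈A , dist = proj₂ A-generates i j i∈X j∈X (i~j , λ u φ⇒∈T u≢i u≢j →
              decidable-stable (d₂ G u i ℕ.≟ d₂ G u j) λ ≢ → none (u , φ⇒∈T , u≢i , u≢j , ≢))
        in a , (λ a≡i → i∉A (subst (_∈ A) a≡i a∈A)) , (λ a≡j → j∉A (subst (_∈ A) a≡j a∈A))
             , ∈M⇒Nonempty (x∈p∪q⁺ (inj₂ a∈A)) , dist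

    upper-bound : adimₗ L ≤ ∑adim + t + ∣ A ∣
    upper-bound = begin
      adimₗ L                                    ≤⟨ adimₗ≤ L (lexGenerator⁺ G H (C.within , across)) ⟩
      ∣ join m C.B ∣                             ≡⟨ ∣join∣≡sum m C.B ⟩
      sum (λ i → ∣ C.B i ∣)                      ≤⟨ sum-mono-≤ C.size ⟩
      sum (λ i → adimₗ (H i) + 𝟙 (lookup M i))   ≡⟨ sum-+-∣p∣ _ M ⟩
      ∑adim + ∣ M ∣                              ≡⟨ cong (∑adim +_) ∣M∣≡t+∣A∣ ⟩
      ∑adim + (t + ∣ A ∣)                        ≡⟨ ℕ.+-assoc ∑adim _ _ ⟨
      ∑adim + t + ∣ A ∣                          ∎
      where open ℕ.≤-Reasoning

theorem7 : ∀ {n k : ℕ} (G : Graph n) {m : Fin n → ℕ} (H : ∀ i → Graph (m i))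
    (U : Fin k → Subset n) (r : Fin k → Fin n) →
    2 ≤ n → Connected G → NonSingletonTrueTwinClasses G U → IsChoice H U r →
    adimₗ (lex G H) ≡ sum (λ i → adimₗ (H i)) + twinSum H U + ϱ′ G H U r
theorem7 {n = n} G H U r _ _ classes choice = ℕ.≤-antisym upper lower
  where
  reps : Representatives G (I H) (X_E G H U r) (T G H U r) (twinSum H U)
  reps = representatives G (I H) U r classes choice

  I⇔𝒢 : ∀ i → i ∈ I H ⇔ 𝒢 (H i)
  I⇔𝒢 i = mk⇔ (∈⟪⟫⁻ (𝒢? ∘ H)) (∈⟪⟫⁺ (𝒢? ∘ H))

  -- This direction lets the set `A` of the lower bound compete in the minimum `ϱ′`; the converse
  -- feeds a minimum set for `ϱ′` into the upper bound.
  R′⇒Related : R′ G H U r i j → Related G H I⇔𝒢 reps i j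
  R′⇒Related {i = i} {j = j} (i~j , same) = i~j , λ u φ⇒∈T u≢i u≢j → same u λ u∈ →
    [ (λ u∈V → x∈p─q⇒x∉q Φs _ u∈V (φ⇒∈T (∈⟪⟫⁻ (Φ? ∘ H) (p─q⊆p Φs _ u∈V))))
    , (λ u∈ij → [ u≢i ∘ x∈⁅y⁆⇒x≡y i , u≢j ∘ x∈⁅y⁆⇒x≡y j ]′ (x∈p∪q⁻ ⁅ i ⁆ ⁅ j ⁆ u∈ij))
    ]′ (x∈p∪q⁻ (V_E G H U r) (⁅ i ⁆ ∪ ⁅ j ⁆) u∈)
    where
    Φs : Subset n
    Φs = ⟪ Φ? ∘ H ⟫

  Related⇒R′ : Related G H I⇔𝒢 reps i j → R′ G H U r i j
  Related⇒R′ {i = i} {j = j} (i~j , same) = i~j , λ u u∉ → same u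
    -- For edgeless `H u`, being outside `V_E` leaves only membership in `T`, which is decidable.
    (λ φ → decidable-stable (u ∈? T G H U r) λ u∉T →
      u∉ (x∈p∪q⁺ (inj₁ (x∈p∧x∉q⇒x∈p─q (∈⟪⟫⁺ (Φ? ∘ H) φ) u∉T))))
    (λ { refl → u∉ (x∈p∪q⁺ (inj₂ (x∈p∪q⁺ (inj₁ (x∈⁅x⁆ u))))) })
    (λ { refl → u∉ (x∈p∪q⁺ (inj₂ (x∈p∪q⁺ (inj₂ (x∈⁅x⁆ u))))) })

  upper : adimₗ (lex G H) ≤ sum (λ i → adimₗ (H i)) + twinSum H U + ϱ′ G H U r
  upper = let A , (A⊆X , gen) , ∣A∣≡ = holds (minR′Generator G H U r) in
    ℕ.≤-trans
      (upper-bound G H I⇔𝒢 reps (A⊆X , λ i j i∈X j∈X R → gen i j i∈X j∈X (Related⇒R′ R)))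
      (ℕ.≤-reflexive (cong (sum (λ i → adimₗ (H i)) + twinSum H U +_) ∣A∣≡))

  lower : sum (λ i → adimₗ (H i)) + twinSum H U + ϱ′ G H U r ≤ adimₗ (lex G H)
  lower =
    let S , gen , ∣S∣≡ = holds (minLocalAdjGenerator (lex G H))
        A , (A⊆X , A-gen) , bound = lower-bound G H I⇔𝒢 reps gen
        A-gen′ : R′Generator G H U r A
        A-gen′ = A⊆X , λ i j i∈X j∈X R → A-gen i j i∈X j∈X (R′⇒Related R)
    in ℕ.≤-trans (ℕ.+-monoʳ-≤ _ (least (minR′Generator G H U r) (A , A-gen′ , refl)))
         (ℕ.≤-trans bound (ℕ.≤-reflexive ∣S∣≡))
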